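{- Let $d\ge 3$, $h\ge1$. The Hall $(d-1)$-subgroup of the sandpile group $G(d,h)$ is cyclic of order $(d-1)^h$.
   Context: Let $\mathcal{T}(d,h)$ be the ball of radius $h$ about a root vertex $0$ in the infinite $d$-regular tree (root has $d$ children, vertices at depth $1,\dots,h-1$ have $d-1$ children, depth-$h$ vertices are leaves). Let $V$ be its vertex set, $p(i)$ the parent of $i\neq 0$, $C_i$ the children of $i$, $\{\mathbf{x}_i\}$ the standard basis of $\mathbb{Z}^V$, and $\delta_i = d\mathbf{x}_i - \mathbf{x}_{p(i)} - \sum_{j\in C_i}\mathbf{x}_j$ (omit $\mathbf{x}_{p(i)}$ for $i=0$). The sandpile group is $G(d,h)=\mathbb{Z}^V/\sum_{i\in V}\mathbb{Z}\delta_i$. A subgroup $H$ of a finite group $G$ is a Hall subgroup if $\gcd(|H|,|G:H|)=1$; it is a Hall $t$-subgroup if moreover $|H|$ and $t$ have the same prime divisors. A finite abelian group has a unique Hall $t$-subgroup for each $t$ dividing its order. -}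

module Defs where

open import Data.Nat using (ℕ; zero; suc; _∸_; _<ᵇ_; _≤ᵇ_; _*_; _^_)
open import Data.Nat.Coprimality using (Coprime)
open import Data.Nat.Divisibility using (_∣_)
open import Data.Nat.Primality using (Prime)
open import Data.Integer as ℤ using (ℤ; 0ℤ; 1ℤ; +_) renaming (_+_ to _+ℤ_; _-_ to _-ℤ_; _*_ to _*ℤ_; -_ to -ℤ_)
open import Data.Bool using (Bool; true; false; T; _∧_; not; if_then_else_)
open import Data.List using (List; []; _∷_; length)
open import Data.List.Properties using (≡-dec)
open import Data.Nat.Properties using (_≟_)
open import Data.Fin using (Fin)
open import Data.Product using (Σ; ∃; ∃-syntax; _×_; _,_; proj₁)
open import Data.Unit using (⊤)
open import Function.Bundles using (_⇔_)
open import Relation.Nullary.Decidable using (⌊_⌋)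
open import Relation.Binary.PropositionalEquality using (_≡_)

-- The ball T(d,h) in the infinite d-regular tree.
-- A vertex is the path from the root, stored in REVERSED order
-- (most recent step first): [] is the root 0, the parent of (a ∷ l) is l,
-- and the children of l are the vertices j ∷ l.  The step taken from the
-- root (the last list element) ranges over {0,…,d-1} (d children of the
-- root), every later step ranges over {0,…,d-2} (d-1 children), and the
-- depth (= length) is at most h.

validSteps : ℕ → List ℕ → Bool
validSteps d []            = true
validSteps d (a ∷ [])      = a <ᵇ d
validSteps d (a ∷ b ∷ l)   = (a <ᵇ (d ∸ 1)) ∧ validSteps d (b ∷ l)

validVertex : ℕ → ℕ → List ℕ → Bool
validVertex d h l = (length l ≤ᵇ h) ∧ validSteps d l

Vertex : ℕ → ℕ → Set
Vertex d h = Σ (List ℕ) (λ l → T (validVertex d h l))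

eqV : ∀ {d h} → Vertex d h → Vertex d h → Bool
eqV (l , _) (l' , _) = ⌊ ≡-dec _≟_ l l' ⌋

isRoot : ∀ {d h} → Vertex d h → Bool
isRoot ([] , _)    = true
isRoot (_ ∷ _ , _) = false

parentIs : ∀ {d h} → Vertex d h → Vertex d h → Bool
parentIs ([] , _)    v        = false
parentIs (_ ∷ l , _) (l' , _) = ⌊ ≡-dec _≟_ l l' ⌋

ZV : ℕ → ℕ → Set
ZV d h = Vertex d h → ℤ

ind : Bool → ℤ
ind b = if b then 1ℤ else 0ℤ

basis : ∀ {d h} → Vertex d h → ZV d h
basis i v = ind (eqV i v)

-- δ_i = d x_i - x_{p(i)} - Σ_{j ∈ C_i} x_j   (x_{p(i)} omitted for i = 0),
-- evaluated at coordinate v.  The children of i are exactly the vertices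
-- j ≠ 0 with p(j) = i, so the coordinate of Σ_{j∈C_i} x_j at v is
-- [v ≠ 0 and p(v) = i].
δ : ∀ d {h} → Vertex d h → ZV d h
δ d i v = ((+ d) *ℤ basis i v -ℤ ind (parentIs i v)) -ℤ ind (parentIs v i)

data InSpan (d h : ℕ) : ZV d h → Set where
  span-zero  : ∀ {x} → (∀ v → x v ≡ 0ℤ) → InSpan d h x
  span-plus  : ∀ {x y} (i : Vertex d h) → InSpan d h y →
               (∀ v → x v ≡ y v +ℤ δ d i v) → InSpan d h x
  span-minus : ∀ {x y} (i : Vertex d h) → InSpan d h y →
               (∀ v → x v ≡ y v -ℤ δ d i v) → InSpan d h x

-- The sandpile group G(d,h) = ℤ^V / Σ ℤ δ_i, presented as ℤ^V with the
-- congruence x ~ y  ⇔  x - y ∈ Σ ℤ δ_i.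

Rel~ : ∀ d h → ZV d h → ZV d h → Set
Rel~ d h x y = InSpan d h (λ v → x v -ℤ y v)

zeroV : ∀ {d h} → ZV d h
zeroV _ = 0ℤ

addV : ∀ {d h} → ZV d h → ZV d h → ZV d h
addV x y v = x v +ℤ y v

negV : ∀ {d h} → ZV d h → ZV d h
negV x v = -ℤ x v

scaleV : ∀ {d h} → ℤ → ZV d h → ZV d h
scaleV k x v = k *ℤ x v

-- A subgroup of G(d,h), given by its preimage in ℤ^V
-- (a subgroup of ℤ^V closed under the congruence ~).
record IsSubgroup (d h : ℕ) (P : ZV d h → Set) : Set where
  field
    resp  : ∀ {x y} → Rel~ d h x y → P x → P y
    has0  : P zeroV
    add   : ∀ {x y} → P x → P y → P (addV x y)
    neg   : ∀ {x} → P x → P (negV x)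

-- The set of classes in G(d,h) of elements satisfying P has exactly m
-- elements: an explicit bijection between Fin m and these classes.
record HasSize (d h : ℕ) (P : ZV d h → Set) (m : ℕ) : Set where
  field
    elem      : Fin m → ZV d h
    index     : ZV d h → Fin m
    elem-in   : ∀ k → P (elem k)
    index-elem : ∀ k → index (elem k) ≡ k
    index-resp : ∀ {x y} → P x → P y → Rel~ d h x y → index x ≡ index y
    elem-index : ∀ {x} → P x → Rel~ d h (elem (index x)) x

GroupOrder : ℕ → ℕ → ℕ → Set
GroupOrder d h N = HasSize d h (λ _ → ⊤) N

-- H is a Hall t-subgroup of G(d,h): |H| = m, |G : H| = k (so |G| = m·k),
-- gcd(m,k) = 1, and m and t have the same prime divisors.
IsHall : (d h t : ℕ) → (ZV d h → Set) → Set
IsHall d h t P =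
  IsSubgroup d h P ×
  ∃[ m ] ∃[ k ] (HasSize d h P m × GroupOrder d h (m * k) × Coprime m k ×
                 (∀ p → Prime p → (p ∣ m ⇔ p ∣ t)))

IsCyclic : (d h : ℕ) → (ZV d h → Set) → Set
IsCyclic d h P = ∃[ g ] (P g × (∀ x → P x → ∃[ k ] Rel~ d h x (scaleV k g)))

{-# OPTIONS --safe #-}
-- Write q = d - 1 and a_n = (q^n - 1)/(q - 1), so that d a_{n+1} = a_{n+2} + q a_n.  Eliminating
-- from the leaves upwards gives a_{n+1} x_v = a_n x_{p(v)} in G(d,h) for v at depth h + 1 - n, and
-- δ_0 then gives q^h g = 0 for g = d x_0.  All a_n with n ≥ 1 and d are prime to q, so a number K
-- prime to q maps G(d,h) into ⟨g⟩.  Pairing with the radial function v ↦ a_{h+1-depth(v)}, which is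
-- harmonic modulo q^h, shows that g has order exactly q^h.  Adjoining the x_v to ⟨g⟩ one at a time
-- multiplies the order by divisors of K, so ⟨g⟩ is a Hall subgroup.  Conversely, a Hall
-- (d-1)-subgroup has order q^h by coprimality, is killed by q^h, hence lies in ⟨g⟩, and so equals it.

module Submission where

open import Defs
open import Data.Empty using (⊥-elim)
open import Data.Fin using (Fin; toℕ; fromℕ<; remQuot; combine) renaming (zero to fzero)
open import Data.Fin.Properties using (any?; toℕ<n; toℕ-fromℕ<; toℕ-injective; remQuot-combine; combine-remQuot; injective⇒≤)
open import Data.Integer using (ℤ; +_; -[1+_]; 0ℤ; 1ℤ; -1ℤ; ∣_∣; _%ℕ_; _/ℕ_)
  renaming (_+_ to _+ℤ_; _-_ to _-ℤ_; _*_ to _*ℤ_; -_ to -ℤ_)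
open import Data.Integer.DivMod using (n%ℕd<d; a≡a%ℕn+[a/ℕn]*n)
open import Data.Integer.Divisibility.Signed using (∣⇒∣ᵤ; divides; quotient; ∣m∣n⇒∣m+n; ∣n⇒∣m*n; ∣m⇒∣m*n) renaming (_∣_ to _∣ℤ_; _∣?_ to _∣ℤ?_)
import Data.Integer.Properties as ℤ
open import Data.Integer.Tactic.RingSolver using (solve-∀)
open import Data.List using (List; []; _∷_; map; tabulate; length; upTo; deduplicate; cartesianProductWith)
open import Data.List.Properties using (≡-dec; length-upTo)
open import Data.List.Relation.Unary.Unique.Propositional using (Unique)
open import Data.List.Relation.Unary.AllPairs using (_∷_)
open import Data.List.Relation.Unary.Unique.Propositional.Properties using (upTo⁺)
open import Data.List.Relation.Unary.Unique.DecPropositional.Properties using (deduplicate-!)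
open import Data.Bool using (T)
open import Data.Bool.Properties using (T-∧; T-irrelevant)
open import Data.List.Membership.Propositional using (_∈_)
open import Data.List.Membership.Propositional.Properties using (∈-tabulate⁺; ∈-tabulate⁻; ∈-map⁺; ∈-map⁻; ∈-upTo⁺; ∈-upTo⁻; ∈-deduplicate⁺; ∈-cartesianProductWith⁺)
open import Data.List.Relation.Unary.Any using (here; there)
open import Data.Nat using (ℕ; zero; suc; _+_; _*_; _∸_; _^_; _≤_; _<_; z≤n; s≤s; NonZero; _⊔_; pred; _≤ᵇ_; s≤s⁻¹; >-nonZero; ≢-nonZero)
open import Data.Nat.Coprimality using (Coprime; coprime-divisor; coprime-Bézout; 0-coprimeTo-m⇒m≡1) renaming (sym to coprime-sym)
open import Data.Nat.Divisibility using (_∣_; ∣-refl; ∣-trans; ∣-antisym; ∣1⇒≡1; m∣m*n; ∣⇒≤; _∣0; ∣m+n∣m⇒∣n)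
open import Data.Nat.GCD using (module Bézout)
open import Data.Nat.Primality using (Prime; prime[2]; euclidsLemma; ¬prime[1])
open import Data.Nat.Primality.Factorisation using (factorise)
open import Data.Nat.ListAction using (product)
open import Data.List.Relation.Unary.All as All using (_∷_)
import Data.Nat.Properties as ℕ
open import Data.Product using (Σ; ∃; ∃-syntax; _×_; _,_; proj₁; proj₂)
open import Data.Sum using (_⊎_; inj₁; inj₂)
open import Data.Unit using (tt)
open import Function using (_∘_)
open import Function.Bundles using (mk⇔; Equivalence)
open import Relation.Binary.PropositionalEquality using (_≡_; _≢_; refl; ≢-sym; sym; trans; cong; cong₂; subst)
open import Relation.Nullary using (¬_; Dec; yes; no; contradiction)
open import Relation.Nullary.Decidable using (map′; ⌊_⌋; T?)

-- Coprimality, residues and bounded search in the natural numbers.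

prime-divisor : ∀ n → n ≢ 1 → ∃[ p ] Prime p × p ∣ n
prime-divisor zero n≢1 = 2 , prime[2] , 2 ∣0
prime-divisor n@(suc _) n≢1 with factorise n
... | record { factors = [] ; isFactorisation = eq } = ⊥-elim (n≢1 eq)
... | record { factors = p ∷ ps ; isFactorisation = eq ; factorsPrime = p-prime ∷ _ } =
  p , p-prime , subst (p ∣_) (sym eq) (m∣m*n (product ps))

-- A common divisor other than 1 would have a prime factor, which would then divide 1. This turns
-- the condition on prime divisors in `IsHall` into coprimality.
coprime-by-primes : ∀ {m n o} → (∀ p → Prime p → p ∣ m → p ∣ n) → Coprime n o → Coprime m o
coprime-by-primes sub cop {i} (i∣m , i∣o) with i ℕ.≟ 1
... | yes i≡1 = i≡1
... | no i≢1 with prime-divisor i i≢1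
...   | p , p-prime , p∣i = contradiction
        (subst Prime (cop (sub p p-prime (∣-trans p∣i i∣m) , ∣-trans p∣i i∣o)) p-prime) ¬prime[1]

coprime-∣ : ∀ {m n o} → m ∣ n → Coprime n o → Coprime m o
coprime-∣ m∣n cop (i∣m , i∣o) = cop (∣-trans i∣m m∣n , i∣o)

coprime-* : ∀ {m n o} → Coprime m o → Coprime n o → Coprime (m * n) o
coprime-* cm cn (i∣mn , i∣o) =
  cn (coprime-divisor (λ { (j∣i , j∣m) → cm (j∣m , ∣-trans j∣i i∣o) }) i∣mn , i∣o)

prime∣^ : ∀ {p} t e → Prime p → p ∣ t ^ e → p ∣ t
prime∣^ t zero p-prime p∣1 = ⊥-elim (¬prime[1] (subst Prime (∣1⇒≡1 p∣1) p-prime))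
prime∣^ t (suc e) p-prime p∣ with euclidsLemma t (t ^ e) p-prime p∣
... | inj₁ p∣t = p∣t
... | inj₂ p∣t^e = prime∣^ t e p-prime p∣t^e

∣∧<⇒≡0 : ∀ {m n} → m ∣ n → n < m → n ≡ 0
∣∧<⇒≡0 {n = zero} _ _ = refl
∣∧<⇒≡0 {n = suc _} m∣n n<m = contradiction (∣⇒≤ m∣n) (ℕ.<⇒≱ n<m)

-- Two residues below r differ by less than r in absolute value, so a difference divisible by r is
-- 0.
∣-⇒toℕ≡ : ∀ {r} (i j : Fin r) → + r ∣ℤ (+ toℕ i -ℤ + toℕ j) → i ≡ j
∣-⇒toℕ≡ {r} i j r∣ = toℕ-injective (ℤ.+-injective (ℤ.i-j≡0⇒i≡j (+ toℕ i) (+ toℕ j)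
  (ℤ.∣i∣≡0⇒i≡0 (∣∧<⇒≡0 (∣⇒∣ᵤ r∣) small))))
  where
  small : ∣ + toℕ i -ℤ + toℕ j ∣ < r
  small = ℕ.≤-<-trans
    (subst (λ z → ∣ z ∣ ≤ toℕ i ⊔ toℕ j) (sym (ℤ.m-n≡m⊖n (toℕ i) (toℕ j))) (ℤ.∣m⊝n∣≤m⊔n (toℕ i) (toℕ j)))
    (ℕ.⊔-lub (toℕ<n i) (toℕ<n j))

-- This search produces the order of an element modulo a lattice. The bound n + 1 takes in n itself,
-- so a search that finds nothing contradicts P n.
least : ∀ {P : ℕ → Set} → (∀ n → Dec (P n)) → ∀ {n} → P n →
        ∃[ m ] P m × (∀ {k} → k < m → ¬ P k)
least {P} P? {n} pn with search (suc n)
  where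
  search : ∀ b → (∃[ m ] P m × (∀ {k} → k < m → ¬ P k)) ⊎ (∀ {k} → k < b → ¬ P k)
  search zero = inj₂ λ ()
  search (suc b) with search b
  ... | inj₁ found = inj₁ found
  ... | inj₂ none with P? b
  ...   | yes pb = inj₁ (b , pb , none)
  ...   | no ¬pb = inj₂ λ { {k} (s≤s k≤b) pk → case k≤b pk }
    where
    case : ∀ {k} → k ≤ b → ¬ P k
    case k≤b pk with ℕ.m≤n⇒m<n∨m≡n k≤b
    ... | inj₁ k<b = none k<b pk
    ... | inj₂ refl = ¬pb pk
... | inj₁ found = found
... | inj₂ none = ⊥-elim (none ℕ.≤-refl pn)

-- Lattices between the span of the δ_i and ℤ^V

module Lattices (d h : ℕ) where

  Z : Set
  Z = ZV d h

  Span : Z → Set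
  Span = InSpan d h

  -- Vectors are functions, so closure is stated up to pointwise equality of z with the combination;
  -- the single field `comb` then yields multiples, sums and differences.
  record IsLattice (A : Z → Set) : Set where
    field
      zero-in : A zeroV
      comb : ∀ m n {s t z} → A s → A t → (∀ v → z v ≡ m *ℤ s v +ℤ n *ℤ t v) → A z

    resp-≗ : ∀ {s z} → A s → (∀ v → z v ≡ s v) → A z
    resp-≗ {s} a eq = comb 1ℤ 0ℤ a a (λ v → trans (eq v) (id (s v)))
      where
      id : ∀ x → x ≡ 1ℤ *ℤ x +ℤ 0ℤ *ℤ x
      id = solve-∀

    scale : ∀ m {s} → A s → A (scaleV m s)
    scale m {s} a = comb m 0ℤ a a (λ v → id m (s v))
      where
      id : ∀ m x → m *ℤ x ≡ m *ℤ x +ℤ 0ℤ *ℤ x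
      id = solve-∀

    plus : ∀ {s t z} → A s → A t → (∀ v → z v ≡ s v +ℤ t v) → A z
    plus {s} {t} a b eq = comb 1ℤ 1ℤ a b (λ v → trans (eq v) (id (s v) (t v)))
      where
      id : ∀ x y → x +ℤ y ≡ 1ℤ *ℤ x +ℤ 1ℤ *ℤ y
      id = solve-∀

    minus : ∀ {s t z} → A s → A t → (∀ v → z v ≡ s v -ℤ t v) → A z
    minus {s} {t} a b eq = comb 1ℤ -1ℤ a b (λ v → trans (eq v) (id (s v) (t v)))
      where
      id : ∀ x y → x -ℤ y ≡ 1ℤ *ℤ x +ℤ -1ℤ *ℤ y
      id = solve-∀

  open IsLattice

  span-resp : ∀ {x y} → Span x → (∀ v → y v ≡ x v) → Span y
  span-resp (span-zero z) eq = span-zero (λ v → trans (eq v) (z v))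
  span-resp (span-plus i s z) eq = span-plus i s (λ v → trans (eq v) (z v))
  span-resp (span-minus i s z) eq = span-minus i s (λ v → trans (eq v) (z v))

  span-add : ∀ {x y z} → Span x → Span y → (∀ v → z v ≡ x v +ℤ y v) → Span z
  span-add {y = y} (span-zero o) t eq =
    span-resp t (λ v → trans (eq v) (trans (cong (_+ℤ y v) (o v)) (ℤ.+-identityˡ (y v))))
  span-add {y = y} (span-plus {y = x} i s o) t eq =
    span-plus i (span-add s t (λ _ → refl))
      (λ v → trans (eq v) (trans (cong (_+ℤ y v) (o v)) (id (x v) (y v) (δ d i v))))
    where
    id : ∀ x y z → (x +ℤ z) +ℤ y ≡ (x +ℤ y) +ℤ z
    id = solve-∀
  span-add {y = y} (span-minus {y = x} i s o) t eq =
    span-minus i (span-add s t (λ _ → refl))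
      (λ v → trans (eq v) (trans (cong (_+ℤ y v) (o v)) (id (x v) (y v) (δ d i v))))
    where
    id : ∀ x y z → (x -ℤ z) +ℤ y ≡ (x +ℤ y) -ℤ z
    id = solve-∀

  span-neg : ∀ {x} → Span x → Span (negV x)
  span-neg (span-zero o) = span-zero (λ v → cong -ℤ_ (o v))
  span-neg (span-plus {y = y} i s o) =
    span-minus i (span-neg s) (λ v → trans (cong -ℤ_ (o v)) (id (y v) (δ d i v)))
    where
    id : ∀ x z → -ℤ (x +ℤ z) ≡ -ℤ x -ℤ z
    id = solve-∀
  span-neg (span-minus {y = y} i s o) =
    span-plus i (span-neg s) (λ v → trans (cong -ℤ_ (o v)) (id (y v) (δ d i v)))
    where
    id : ∀ x z → -ℤ (x -ℤ z) ≡ -ℤ x +ℤ z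
    id = solve-∀

  module _ {A : Z → Set} (zero-in : A zeroV)
           (resp : ∀ {x y} → A x → (∀ v → y v ≡ x v) → A y)
           (add : ∀ {x y} → A x → A y → A (addV x y))
           (neg : ∀ {x} → A x → A (negV x)) where

    multiple : ∀ n {x} → A x → A (scaleV (+ n) x)
    multiple zero {x} a = resp zero-in (λ v → ℤ.*-zeroˡ (x v))
    multiple (suc n) {x} a = resp (add a (multiple n a)) (λ v → ℤ.suc-* (+ n) (x v))

    multipleℤ : ∀ k {x} → A x → A (scaleV k x)
    multipleℤ (+ n) a = multiple n a
    multipleℤ -[1+ n ] {x} a =
      resp (neg (multiple (suc n) a)) (λ v → sym (ℤ.neg-distribˡ-* (+ suc n) (x v)))

    group⇒lattice : IsLattice A
    group⇒lattice .IsLattice.zero-in = zero-in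
    group⇒lattice .comb m n a b eq = resp (add (multipleℤ m a) (multipleℤ n b)) eq

  span-lattice : IsLattice Span
  span-lattice = group⇒lattice (span-zero (λ _ → refl)) span-resp
    (λ s t → span-add s t (λ _ → refl)) span-neg

  span-δ : ∀ i → Span (δ d i)
  span-δ i = span-plus i (span-zero {x = zeroV} (λ _ → refl)) (λ v → sym (ℤ.+-identityˡ _))

  -- Minimality of `Span`: closure properties of the relations need to be checked on each δ_i only.
  -- It serves both the pairing `φ` and the decision of membership.
  span⊆ : ∀ {A} → IsLattice A → (∀ i → A (δ d i)) → ∀ {x} → Span x → A x
  span⊆ L gen (span-zero o) = resp-≗ L (L .zero-in) o
  span⊆ L gen (span-plus i s o) = plus L (span⊆ L gen s) (gen i) o
  span⊆ L gen (span-minus i s o) = minus L (span⊆ L gen s) (gen i) o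

  subgroup⇒lattice : ∀ {A} → IsSubgroup d h A → IsLattice A
  subgroup⇒lattice S = group⇒lattice has0
    (λ {x} {y} a eq → resp (span-zero (λ v → ℤ.i≡j⇒i-j≡0 (sym (eq v)))) a) add neg
    where open IsSubgroup S

  subgroup-span : ∀ {A} → IsSubgroup d h A → ∀ {x} → Span x → A x
  subgroup-span S {x} s = resp (span-neg-resp s) has0
    where
    open IsSubgroup S
    span-neg-resp : Span x → Span (λ v → 0ℤ -ℤ x v)
    span-neg-resp s = span-resp (span-neg s) (λ v → ℤ.+-identityˡ (-ℤ x v))

  lattice⇒subgroup : ∀ {A} → IsLattice A → (∀ {x} → Span x → A x) → IsSubgroup d h A
  lattice⇒subgroup L sub = record
    { resp = λ {x} {y} s a → minus L a (sub s) (λ v → id₁ (x v) (y v))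
    ; has0 = L .zero-in
    ; add = λ a b → plus L a b (λ _ → refl)
    ; neg = λ {x} a → resp-≗ L (scale L -1ℤ a) (λ v → id₂ (x v))
    }
    where
    id₁ : ∀ x y → y ≡ x -ℤ (x -ℤ y)
    id₁ = solve-∀
    id₂ : ∀ x → -ℤ x ≡ -1ℤ *ℤ x
    id₂ = solve-∀

  -- The sum A + ℤg, where the coefficient of g need not be unique. In particular `Ext Span g` is
  -- the preimage of the cyclic subgroup ⟨g⟩ of G(d,h).
  record Ext (A : Z → Set) (g x : Z) : Set where
    constructor ext
    field
      coeff : ℤ
      member : A (λ v → x v -ℤ coeff *ℤ g v)

  gen : (Z → Set) → List Z → Z → Set
  gen A [] = A
  gen A (g ∷ gs) = Ext (gen A gs) g

  module _ {A : Z → Set} (L : IsLattice A) (g : Z) where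

    ext-⊇ : ∀ {x} → A x → Ext A g x
    ext-⊇ {x} a = ext 0ℤ (resp-≗ L a (λ v → id (x v) (g v)))
      where
      id : ∀ x g → x -ℤ 0ℤ *ℤ g ≡ x
      id = solve-∀

    ext-∋ : Ext A g g
    ext-∋ = ext 1ℤ (resp-≗ L (L .zero-in) (λ v → id (g v)))
      where
      id : ∀ g → g -ℤ 1ℤ *ℤ g ≡ 0ℤ
      id = solve-∀

    ext-lattice : IsLattice (Ext A g)
    ext-lattice .IsLattice.zero-in = ext-⊇ (L .zero-in)
    ext-lattice .comb m n {s} {t} {z} (ext k a) (ext l b) eq =
      ext (m *ℤ k +ℤ n *ℤ l) (L .comb m n a b
        (λ v → trans (cong (_-ℤ (m *ℤ k +ℤ n *ℤ l) *ℤ g v) (eq v)) (id m n k l (s v) (t v) (g v))))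
      where
      id : ∀ m n k l s t g → (m *ℤ s +ℤ n *ℤ t) -ℤ (m *ℤ k +ℤ n *ℤ l) *ℤ g
           ≡ m *ℤ (s -ℤ k *ℤ g) +ℤ n *ℤ (t -ℤ l *ℤ g)
      id = solve-∀

  ext-⊆ : ∀ {A B g} → IsLattice B → (∀ {x} → A x → B x) → B g → ∀ {x} → Ext A g x → B x
  ext-⊆ {g = g} LB sub b {x} (ext k a) = plus LB (sub a) (scale LB k b) (λ v → id (x v) (k *ℤ g v))
    where
    id : ∀ x y → x ≡ (x -ℤ y) +ℤ y
    id = solve-∀

  gen-lattice : ∀ {A} → IsLattice A → ∀ gs → IsLattice (gen A gs)
  gen-lattice L [] = L
  gen-lattice L (g ∷ gs) = ext-lattice (gen-lattice L gs) g

  gen-⊇ : ∀ {A} → IsLattice A → ∀ gs {x} → A x → gen A gs x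
  gen-⊇ L [] a = a
  gen-⊇ L (g ∷ gs) a = ext-⊇ (gen-lattice L gs) g (gen-⊇ L gs a)

  gen-∋ : ∀ {A} → IsLattice A → ∀ {gs g} → g ∈ gs → gen A gs g
  gen-∋ L {g ∷ gs} (here refl) = ext-∋ (gen-lattice L gs) g
  gen-∋ L {g ∷ gs} (there g∈) = ext-⊇ (gen-lattice L gs) g (gen-∋ L g∈)

  gen-⊆ : ∀ {A B} → IsLattice B → (∀ {x} → A x → B x) →
          ∀ gs → (∀ {g} → g ∈ gs → B g) → ∀ {x} → gen A gs x → B x
  gen-⊆ LB sub [] in-B a = sub a
  gen-⊆ LB sub (g ∷ gs) in-B a =
    ext-⊆ LB (gen-⊆ LB sub gs (in-B ∘ there)) (in-B (here refl)) a

  -- Let r be the order of g modulo A, which exists because M g lies in A. Every x in A + ℤg has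
  -- exactly one digit j < r with x - j g in A; this decides membership in A + ℤg and counts its
  -- classes.
  module Extension {A : Z → Set} (L : IsLattice A) (A? : ∀ x → Dec (A x))
           {M : ℕ} {{_ : NonZero M}} {g : Z} (Mg : A (scaleV (+ M) g)) where

    private
      -- Searching over `suc m` skips the zero multiple, so r is positive and can serve as a
      -- modulus.
      first : ∃[ m ] A (scaleV (+ suc m) g) × (∀ {k} → k < m → ¬ A (scaleV (+ suc k) g))
      first = least {λ n → A (scaleV (+ suc n) g)} (λ n → A? (scaleV (+ suc n) g)) {pred M}
                (subst (λ n → A (scaleV (+ n) g)) (sym (ℕ.suc-pred M)) Mg)

    r : ℕ
    r = suc (proj₁ first)

    r-in : A (scaleV (+ r) g)
    r-in = proj₁ (proj₂ first)

    remainder-in : ∀ (k : ℤ) (x : Z) → A (λ v → x v -ℤ k *ℤ g v) → A (λ v → x v -ℤ + (k %ℕ r) *ℤ g v)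
    remainder-in k x a = plus L a (scale L (k /ℕ r) r-in)
      (λ v → trans (id (x v) (+ (k %ℕ r)) (k /ℕ r) (+ r) (g v))
                   (cong (λ m → (x v -ℤ m *ℤ g v) +ℤ (k /ℕ r) *ℤ (+ r *ℤ g v)) (sym (a≡a%ℕn+[a/ℕn]*n k r))))
      where
      id : ∀ x m c r g → x -ℤ m *ℤ g ≡ (x -ℤ (m +ℤ c *ℤ r) *ℤ g) +ℤ c *ℤ (r *ℤ g)
      id = solve-∀

    -- The remainder of k modulo r also sends g into A, and minimality of r forces it to be 0.
    order-∣ : ∀ k → A (scaleV k g) → + r ∣ℤ k
    order-∣ k a = divides (k /ℕ r)
      (trans (a≡a%ℕn+[a/ℕn]*n k r)
        (trans (cong (λ m → + m +ℤ (k /ℕ r) *ℤ + r) (rem≡0 (k %ℕ r) (n%ℕd<d k r) rem-in)) (ℤ.+-identityˡ _)))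
      where
      id : ∀ k g → 0ℤ -ℤ k *ℤ g ≡ -1ℤ *ℤ (k *ℤ g)
      id = solve-∀
      id′ : ∀ k g → k *ℤ g ≡ -1ℤ *ℤ (0ℤ -ℤ k *ℤ g)
      id′ = solve-∀
      rem-in : A (scaleV (+ (k %ℕ r)) g)
      rem-in = resp-≗ L (scale L -1ℤ (remainder-in k zeroV
                 (resp-≗ L (scale L -1ℤ a) (λ v → id k (g v)))))
               (λ v → id′ (+ (k %ℕ r)) (g v))
      rem≡0 : ∀ m → m < r → A (scaleV (+ m) g) → m ≡ 0
      rem≡0 zero _ _ = refl
      rem≡0 (suc m) (s≤s m<r) b = ⊥-elim (proj₂ (proj₂ first) m<r b)

    r∣M : r ∣ M
    r∣M = ∣⇒∣ᵤ (order-∣ (+ M) Mg)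

    private
      candidate : Z → Fin r → Set
      candidate x j = A (λ v → x v -ℤ + toℕ j *ℤ g v)

      candidate? : ∀ x → Dec (∃ (candidate x))
      candidate? x = any? (λ j → A? (λ v → x v -ℤ + toℕ j *ℤ g v))

      to-candidate : ∀ {x} → Ext A g x → ∃ (candidate x)
      to-candidate {x} (ext k a) = fromℕ< (n%ℕd<d k r) ,
        subst (λ m → A (λ v → x v -ℤ + m *ℤ g v)) (sym (toℕ-fromℕ< (n%ℕd<d k r))) (remainder-in k x a)

    ext? : ∀ x → Dec (Ext A g x)
    ext? x = map′ (λ { (j , a) → ext (+ toℕ j) a }) to-candidate (candidate? x)

    private
      digit : Z → Fin r
      digit x with candidate? x
      ... | yes (j , _) = j
      -- A default for x outside A + ℤg; `digit-in` makes a claim about members only.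
      ... | no _ = fzero

      digit-in : ∀ {x} → Ext A g x → candidate x (digit x)
      digit-in {x} e with candidate? x
      ... | yes (_ , a) = a
      ... | no none = ⊥-elim (none (to-candidate e))

      -- Subtracting the two memberships leaves (i - j) g in A, so r divides i - j.
      candidate-unique : ∀ x y {i j} → candidate x i → candidate y j → A (λ v → x v -ℤ y v) → i ≡ j
      candidate-unique x y {i} {j} a b c = ∣-⇒toℕ≡ i j (order-∣ (+ toℕ i -ℤ + toℕ j)
        (minus L (plus L c b (λ _ → refl)) a (λ v → id (x v) (y v) (+ toℕ i) (+ toℕ j) (g v))))
        where
        id : ∀ x y i j g → (i -ℤ j) *ℤ g ≡ ((x -ℤ y) +ℤ (y -ℤ j *ℤ g)) -ℤ (x -ℤ i *ℤ g)
        id = solve-∀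

    -- A class of A + ℤg corresponds to its digit together with the class of the reduced vector in
    -- A. Since A contains `Span`, congruent vectors have equal digits.
    ext-size : (∀ {x} → Span x → A x) → ∀ {n} → HasSize d h A n → HasSize d h (Ext A g) (n * r)
    ext-size sub {n} S = record
      { elem = λ i → let a , b = remQuot r i in at a b
      ; index = idx
      ; elem-in = λ i → let a , b = remQuot r i in ext (+ toℕ b) (resp-≗ L (S.elem-in a) (λ v → id₁ (S.elem a v) (+ toℕ b *ℤ g v)))
      ; index-elem = λ i → let a , b = remQuot {n} r i in
          trans (idx-at a b) (combine-remQuot {n} r i)
      ; index-resp = idx-resp
      ; elem-index = λ {x} e → subst (λ (a , b) → Rel~ d h (at a b) x)
          (sym (remQuot-combine (S.index (reduced x)) (digit x)))
          (span-resp (S.elem-index (digit-in e))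
            (λ v → id₂ (S.elem (S.index (reduced x)) v) (+ toℕ (digit x) *ℤ g v) (x v)))
      }
      where
      module S = HasSize S
      id₁ : ∀ x y → (x +ℤ y) -ℤ y ≡ x
      id₁ = solve-∀
      id₂ : ∀ a b x → (a +ℤ b) -ℤ x ≡ a -ℤ (x -ℤ b)
      id₂ = solve-∀
      id₃ : ∀ x y g → x -ℤ y ≡ (x -ℤ g) -ℤ (y -ℤ g)
      id₃ = solve-∀
      at : Fin n → Fin r → Z
      at a b v = S.elem a v +ℤ + toℕ b *ℤ g v
      reduced : Z → Z
      reduced x v = x v -ℤ + toℕ (digit x) *ℤ g v
      idx : Z → Fin (n * r)
      idx x = combine (S.index (reduced x)) (digit x)
      idx-at : ∀ a b → idx (at a b) ≡ combine a b
      idx-at a b = cong₂ combine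
        (trans (S.index-resp (digit-in in-ext) (S.elem-in a) diff) (S.index-elem a)) digit≡
        where
        candidate-b : candidate (at a b) b
        candidate-b = resp-≗ L (S.elem-in a) (λ v → id₁ (S.elem a v) (+ toℕ b *ℤ g v))
        in-ext : Ext A g (at a b)
        in-ext = ext (+ toℕ b) candidate-b
        digit≡ : digit (at a b) ≡ b
        digit≡ = candidate-unique (at a b) (at a b) (digit-in in-ext) candidate-b
          (resp-≗ L (L .zero-in) (λ v → ℤ.i≡j⇒i-j≡0 (refl {x = at a b v})))
        diff : Rel~ d h (reduced (at a b)) (S.elem a)
        diff = span-zero (λ v → ℤ.i≡j⇒i-j≡0
          (trans (cong (λ j → at a b v -ℤ + toℕ j *ℤ g v) digit≡) (id₁ (S.elem a v) (+ toℕ b *ℤ g v))))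
      idx-resp : ∀ {x y} → Ext A g x → Ext A g y → Rel~ d h x y → idx x ≡ idx y
      idx-resp {x} {y} e f x~y = cong₂ combine
        (S.index-resp (digit-in e) (digit-in f)
          (span-resp x~y (λ v → trans (cong (λ j → reduced x v -ℤ (y v -ℤ + toℕ j *ℤ g v)) (sym digit≡))
                                       (sym (id₃ (x v) (y v) (+ toℕ (digit x) *ℤ g v))))))
        digit≡
        where
        digit≡ : digit x ≡ digit y
        digit≡ = candidate-unique x y (digit-in e) (digit-in f) (sub x~y)

-- Orders and Hall subgroups

module Hall (d h : ℕ) where
  open Lattices d h
  open IsLattice

  -- Sending a representative of one enumeration to its index in the other is injective, since
  -- representatives with equal index are congruent to the same vector. Apply this in both
  -- directions.
  size-unique : ∀ {P m n} → HasSize d h P m → HasSize d h P n → m ≡ n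
  size-unique {P} S T = ℕ.≤-antisym (size-≤ S T) (size-≤ T S)
    where
    size-≤ : ∀ {m n} → HasSize d h P m → HasSize d h P n → m ≤ n
    size-≤ S T = injective⇒≤ {f = T.index ∘ S.elem} inj
      where
      module S = HasSize S
      module T = HasSize T
      id : ∀ a b t → a -ℤ b ≡ (t -ℤ b) -ℤ (t -ℤ a)
      id = solve-∀
      inj : ∀ {i j} → T.index (S.elem i) ≡ T.index (S.elem j) → i ≡ j
      inj {i} {j} eq = trans (sym (S.index-elem i)) (trans
        (S.index-resp (S.elem-in i) (S.elem-in j)
          (minus span-lattice (T.elem-index (S.elem-in j))
            (subst (λ k → Rel~ d h (T.elem k) (S.elem i)) eq (T.elem-index (S.elem-in i)))
            (λ v → id (S.elem i v) (S.elem j v) (T.elem (T.index (S.elem j)) v))))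
        (S.index-elem j))

  size-resp : ∀ {P Q} → (∀ {x} → P x → Q x) → (∀ {x} → Q x → P x) →
              ∀ {n} → HasSize d h P n → HasSize d h Q n
  size-resp to from S = record
    { elem = elem ; index = index ; elem-in = to ∘ elem-in ; index-elem = index-elem
    ; index-resp = λ a b → index-resp (from a) (from b) ; elem-index = elem-index ∘ from }
    where open HasSize S

  size-span : HasSize d h Span 1
  size-span = record
    { elem = λ _ → zeroV ; index = λ _ → fzero ; elem-in = λ _ → span-zero (λ _ → refl)
    ; index-elem = λ { fzero → refl } ; index-resp = λ _ _ _ → refl
    ; elem-index = λ {x} s → span-resp (scale span-lattice -1ℤ s) (λ v → id (x v)) }
    where
    id : ∀ x → 0ℤ -ℤ x ≡ -1ℤ *ℤ x
    id = solve-∀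

  module _ {M : ℕ} {{_ : NonZero M}} {A : Z → Set} (L : IsLattice A) (A? : ∀ x → Dec (A x)) where

    gen? : ∀ gs → (∀ {g} → g ∈ gs → A (scaleV (+ M) g)) → ∀ x → Dec (gen A gs x)
    gen? [] kill = A?
    gen? (g ∷ gs) kill = Extension.ext? (gen-lattice L gs) (gen? gs (kill ∘ there))
      {M} (gen-⊇ L gs (kill (here refl)))

    -- Each adjunction multiplies the order by some r dividing M, so the total factor R is a product
    -- of divisors of M and inherits every coprimality of M.
    gen-size : (∀ {x} → Span x → A x) → ∀ gs → (∀ {g} → g ∈ gs → A (scaleV (+ M) g)) →
               ∀ {n} → HasSize d h A n →
               ∃[ R ] HasSize d h (gen A gs) (n * R) × (∀ {c} → Coprime M c → Coprime R c)
    gen-size sub [] kill {n} S =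
      1 , subst (HasSize d h A) (sym (ℕ.*-identityʳ n)) S , λ _ (i∣1 , _) → ∣1⇒≡1 i∣1
    gen-size sub (g ∷ gs) kill {n} S with gen-size sub gs (kill ∘ there) S
    ... | R , T , cop = R * E.r ,
      subst (HasSize d h (gen A (g ∷ gs))) (ℕ.*-assoc n R E.r) (E.ext-size (gen-⊇ L gs ∘ sub) T) ,
      λ cM → coprime-* {R} (cop cM) (coprime-∣ E.r∣M cM)
      where
      module E = Extension (gen-lattice L gs) (gen? gs (kill ∘ there)) {M} (gen-⊇ L gs (kill (here refl)))

  module _ {g : Z} {T : ℕ} (killed : Span (scaleV (+ T) g)) where

    kill-ext : ∀ {x} → Ext Span g x → Span (scaleV (+ T) x)
    kill-ext {x} (ext k s) = plus span-lattice (scale span-lattice (+ T) s)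
      (scale span-lattice k killed) (λ v → id (+ T) k (x v) (g v))
      where
      id : ∀ m k x g → m *ℤ x ≡ m *ℤ (x -ℤ k *ℤ g) +ℤ k *ℤ (m *ℤ g)
      id = solve-∀

    -- K moves x into ⟨g⟩, and T annihilates ⟨g⟩.
    kill-all : ∀ {K} → (∀ x → Ext Span g (scaleV (+ K) x)) → ∀ x → Span (scaleV (+ (T * K)) x)
    kill-all {K} reduce x = resp-≗ span-lattice (kill-ext (reduce x))
      (λ v → trans (cong (_*ℤ x v) (ℤ.pos-* T K)) (ℤ.*-assoc (+ T) (+ K) (x v)))

  -- Besides decidability and a finite spanning list, all that the Hall argument takes from the tree
  -- is this: g has order exactly t^e, and some K prime to t maps the whole group into ⟨g⟩.
  module _ (span? : ∀ x → Dec (Span x)) (bases : List Z)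
           (spanning : ∀ {B} → IsLattice B → (∀ {b} → b ∈ bases → B b) → ∀ x → B x)
           {t e : ℕ} (t≢0 : NonZero t) (e≢0 : NonZero e)
           (g : Z) (killed : Span (scaleV (+ (t ^ e)) g))
           (faithful : ∀ r → Span (scaleV (+ r) g) → t ^ e ∣ r)
           {K : ℕ} (K≢0 : NonZero K) (coprime-K : Coprime K t)
           (reduce : ∀ x → Ext Span g (scaleV (+ K) x)) where

    private
      instance
        nonzero-K = K≢0
        nonzero-t = t≢0
        nonzero-t^e = ℕ.m^n≢0 t e
        nonzero-N = ℕ.m*n≢0 (t ^ e) K

      N : ℕ
      N = t ^ e * K

      P : Z → Set
      P = Ext Span g

      P-lattice : IsLattice P
      P-lattice = ext-lattice span-lattice g

      module P = Extension span-lattice span? {t ^ e} killed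

      -- The order of g divides t^e by `killed` and is a multiple of t^e by `faithful`.
      P-size : HasSize d h P (t ^ e)
      P-size = subst (HasSize d h P) (trans (ℕ.*-identityˡ P.r) (∣-antisym P.r∣M (faithful P.r P.r-in)))
                 (P.ext-size (λ s → s) size-span)

      kill : ∀ x → Span (scaleV (+ N) x)
      kill = kill-all {g} {t ^ e} killed {K} reduce

      coprime-^ : ∀ {c} → Coprime t c → Coprime (t ^ e) c
      coprime-^ = coprime-by-primes (λ p → prime∣^ t e)

      -- Here e ≥ 1 enters: t^e must have all the prime divisors of t.
      t∣t^e : t ∣ t ^ e
      t∣t^e = subst (λ n → t ∣ t ^ n) (ℕ.suc-pred e {{e≢0}}) (m∣m*n (t ^ pred e))

      -- Adjoining all basis vectors to P reaches ℤ^V. As K sends each of them into P, the index R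
      -- is prime to whatever K is prime to.
      total : ∃[ R ] HasSize d h (gen P bases) (t ^ e * R) × (∀ {c} → Coprime K c → Coprime R c)
      total = gen-size {K} P-lattice P.ext? (ext-⊇ span-lattice g) bases (λ {b} _ → reduce b) P-size

      R : ℕ
      R = proj₁ total

      order : GroupOrder d h (t ^ e * R)
      order = size-resp (λ _ → tt)
        (λ {x} _ → spanning (gen-lattice P-lattice bases) (gen-∋ P-lattice) x) (proj₁ (proj₂ total))

      coprime-R : Coprime t R
      coprime-R = coprime-sym (proj₂ (proj₂ total) coprime-K)

    hall : IsHall d h t P
    hall = lattice⇒subgroup P-lattice (ext-⊇ span-lattice g) , t ^ e , R , P-size , order ,
           coprime-^ coprime-R , λ p pp → mk⇔ (prime∣^ t e pp) (λ p∣t → ∣-trans p∣t t∣t^e)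

    private
      -- A Bézout combination of t^e and K recovers x from K x when t^e x vanishes.
      torsion⊆P : ∀ {x} → Span (scaleV (+ (t ^ e)) x) → P x
      torsion⊆P {x} s = P-bezout (coprime-Bézout (coprime-^ (coprime-sym coprime-K)))
        where
        Kx : P (scaleV (+ K) x)
        Kx = reduce x
        tx : P (scaleV (+ (t ^ e)) x)
        tx = ext-⊇ span-lattice g s
        id : ∀ a b m n x → 1ℤ +ℤ b *ℤ n ≡ a *ℤ m → x ≡ a *ℤ (m *ℤ x) +ℤ (-ℤ b) *ℤ (n *ℤ x)
        id a b m n x eq = trans (id₁ b n x) (trans (cong (λ c → c *ℤ x -ℤ b *ℤ n *ℤ x) eq) (id₂ a b m n x))
          where
          id₁ : ∀ b n x → x ≡ (1ℤ +ℤ b *ℤ n) *ℤ x -ℤ b *ℤ n *ℤ x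
          id₁ = solve-∀
          id₂ : ∀ a b m n x → a *ℤ m *ℤ x -ℤ b *ℤ n *ℤ x ≡ a *ℤ (m *ℤ x) +ℤ (-ℤ b) *ℤ (n *ℤ x)
          id₂ = solve-∀
        cast : ∀ a b m n → 1 + b * n ≡ a * m → 1ℤ +ℤ + b *ℤ + n ≡ + a *ℤ + m
        cast a b m n eq = trans (cong (1ℤ +ℤ_) (sym (ℤ.pos-* b n))) (trans (cong +_ eq) (ℤ.pos-* a m))
        P-bezout : Bézout.Identity 1 (t ^ e) K → P x
        P-bezout (Bézout.+- a b eq) = comb P-lattice (+ a) (-ℤ + b) tx Kx
          (λ v → id (+ a) (+ b) (+ (t ^ e)) (+ K) (x v) (cast a b (t ^ e) K eq))
        P-bezout (Bézout.-+ a b eq) = comb P-lattice (+ b) (-ℤ + a) Kx tx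
          (λ v → id (+ b) (+ a) (+ K) (+ (t ^ e)) (x v) (cast b a K (t ^ e) eq))

    hall-unique : ∀ Q → IsHall d h t Q → IsCyclic d h Q × HasSize d h Q (t ^ e)
    hall-unique Q (Q-subgroup , m , k , Q-size , order′ , coprime-mk , primes) =
      (g , g∈Q , λ x x∈Q → let ext c s = Q⊆P x∈Q in c , s) , subst (HasSize d h Q) m≡t^e Q-size
      where
      module Q = HasSize Q-size
      Q-lattice : IsLattice Q
      Q-lattice = subgroup⇒lattice Q-subgroup
      span⊆Q : ∀ {x} → Span x → Q x
      span⊆Q = subgroup-span Q-subgroup

      mk≡ : m * k ≡ t ^ e * R
      mk≡ = size-unique order′ order
      coprime-mR : Coprime m R
      coprime-mR = coprime-by-primes (λ p pp → Equivalence.to (primes p pp)) coprime-R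
      coprime-t^e-k : Coprime (t ^ e) k
      coprime-t^e-k = coprime-by-primes
        (λ p pp p∣ → Equivalence.from (primes p pp) (prime∣^ t e pp p∣)) coprime-mk
      -- In m k = t^e R, the factor m is prime to R and t^e is prime to k, so each of m and t^e
      -- divides the other.
      m≡t^e : m ≡ t ^ e
      m≡t^e = ∣-antisym
        (coprime-divisor coprime-mR (subst (m ∣_) (trans mk≡ (ℕ.*-comm (t ^ e) R)) (m∣m*n k)))
        (coprime-divisor coprime-t^e-k (subst (t ^ e ∣_) (trans (sym mk≡) (ℕ.*-comm m k)) (m∣m*n R)))

      elems : List Z
      elems = tabulate Q.elem
      elems-in : ∀ {x} → x ∈ elems → Q x
      elems-in x∈ with i , refl ← ∈-tabulate⁻ x∈ = Q.elem-in i
      Q⊆ : ∀ {B} → IsLattice B → (∀ {x} → Span x → B x) → (∀ {x} → x ∈ elems → B x) → ∀ {x} → Q x → B x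
      Q⊆ LB sub in-B {x} q = minus LB (in-B (∈-tabulate⁺ (Q.index x))) (sub (Q.elem-index q))
        (λ v → id (x v) (Q.elem (Q.index x) v))
        where
        id : ∀ x y → x ≡ y -ℤ (y -ℤ x)
        id = solve-∀
      -- Q is an arbitrary predicate, but it is generated over `Span` by its finitely many
      -- representatives, each killed by N, which makes it decidable.
      Q? : ∀ x → Dec (Q x)
      Q? x = map′ (gen-⊆ Q-lattice span⊆Q elems elems-in)
        (Q⊆ (gen-lattice span-lattice elems) (gen-⊇ span-lattice elems) (gen-∋ span-lattice))
        (gen? {N} span-lattice span? elems (λ {y} _ → kill y) x)

      -- Extending Span first by x and then by representatives of Q reaches Q, so the order of x divides m.
      lagrange : ∀ {x} → Q x → Span (scaleV (+ m) x)
      lagrange {x} x∈Q = resp-≗ span-lattice (scale span-lattice (+ R′) E.r-in)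
        (λ v → trans (cong (_*ℤ x v) (trans (cong +_ m≡) (ℤ.pos-* R′ E.r))) (ℤ.*-assoc (+ R′) (+ E.r) (x v)))
        where
        module E = Extension span-lattice span? {N} (kill x)
        X-lattice : IsLattice (Ext Span x)
        X-lattice = ext-lattice span-lattice x
        chain = gen-size {N} X-lattice E.ext? (ext-⊇ span-lattice x) elems
                  (λ {y} _ → ext-⊇ span-lattice x (kill y)) (E.ext-size (λ s → s) size-span)
        R′ : ℕ
        R′ = proj₁ chain
        m≡ : m ≡ R′ * E.r
        m≡ = trans (size-unique Q-size
          (size-resp (gen-⊆ Q-lattice (ext-⊆ Q-lattice span⊆Q x∈Q) elems elems-in)
            (Q⊆ (gen-lattice X-lattice elems) (gen-⊇ X-lattice elems ∘ ext-⊇ span-lattice x)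
              (gen-∋ X-lattice))
            (proj₁ (proj₂ chain))))
          (trans (cong (_* R′) (ℕ.*-identityˡ E.r)) (ℕ.*-comm E.r R′))

      Q⊆P : ∀ {x} → Q x → P x
      Q⊆P {x} x∈Q = torsion⊆P (subst (λ n → Span (scaleV (+ n) x)) m≡t^e (lagrange x∈Q))

      -- Q + ⟨g⟩ = P has as many elements as Q, so g has order 1 modulo Q.
      g∈Q : Q g
      g∈Q = resp-≗ Q-lattice (subst (λ n → Q (scaleV (+ n) g)) r≡1 E.r-in) (λ v → sym (ℤ.*-identityˡ (g v)))
        where
        module E = Extension Q-lattice Q? {t ^ e} (span⊆Q killed)
        r≡1 : E.r ≡ 1
        r≡1 = ℕ.*-cancelˡ-≡ E.r 1 (t ^ e) (trans
          (size-unique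
            (size-resp (ext-⊆ P-lattice Q⊆P (ext-∋ span-lattice g)) (ext-⊆ (ext-lattice Q-lattice g) (ext-⊇ Q-lattice g ∘ span⊆Q) (ext-∋ Q-lattice g))
              (E.ext-size span⊆Q (subst (HasSize d h Q) m≡t^e Q-size)))
            P-size)
          (sym (ℕ.*-identityʳ (t ^ e))))

-- Finite integer sums over lists.

∑ : ∀ {A : Set} → List A → (A → ℤ) → ℤ
∑ [] f = 0ℤ
∑ (x ∷ xs) f = f x +ℤ ∑ xs f

module _ {A : Set} where

  ∑-zero : ∀ (xs : List A) {f} → (∀ {x} → x ∈ xs → f x ≡ 0ℤ) → ∑ xs f ≡ 0ℤ
  ∑-zero [] z = refl
  ∑-zero (x ∷ xs) z = cong₂ _+ℤ_ (z (here refl)) (∑-zero xs (z ∘ there))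

  ∑-single : ∀ {xs : List A} {i f} → Unique xs → i ∈ xs → (∀ x → i ≢ x → f x ≡ 0ℤ) → ∑ xs f ≡ f i
  ∑-single {x ∷ xs} {i} {f} (x∉ ∷ u) (here refl) z =
    trans (cong (f i +ℤ_) (∑-zero xs (λ {y} y∈ → z y (All.lookup x∉ y∈)))) (ℤ.+-identityʳ (f i))
  ∑-single {x ∷ xs} {i} {f} (x∉ ∷ u) (there i∈) z =
    trans (cong (_+ℤ ∑ xs f) (z x (≢-sym (All.lookup x∉ i∈))))
      (trans (ℤ.+-identityˡ _) (∑-single u i∈ z))

  ∑-comb : ∀ (xs : List A) m n {f g k} → (∀ x → k x ≡ m *ℤ f x +ℤ n *ℤ g x) →
           ∑ xs k ≡ m *ℤ ∑ xs f +ℤ n *ℤ ∑ xs g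
  ∑-comb [] m n eq = id m n
    where
    id : ∀ m n → 0ℤ ≡ m *ℤ 0ℤ +ℤ n *ℤ 0ℤ
    id = solve-∀
  ∑-comb (x ∷ xs) m n {f} {g} eq =
    trans (cong₂ _+ℤ_ (eq x) (∑-comb xs m n eq)) (id m n (f x) (g x) (∑ xs f) (∑ xs g))
    where
    id : ∀ m n a b c d → (m *ℤ a +ℤ n *ℤ b) +ℤ (m *ℤ c +ℤ n *ℤ d) ≡ m *ℤ (a +ℤ c) +ℤ n *ℤ (b +ℤ d)
    id = solve-∀

-- The sandpile group of the tree

module Tree (q h : ℕ) where

  d : ℕ
  d = suc q

  open Lattices d h
  open IsLattice
  open Hall d h

  -- Enumeration of the vertices and the standard basis.

  branch : List ℕ → ℕ
  branch [] = d
  branch (_ ∷ _) = q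

  steps-∷⁻ : ∀ a l → T (validSteps d (a ∷ l)) → a < branch l × T (validSteps d l)
  steps-∷⁻ a [] v = ℕ.<ᵇ⇒< a d v , tt
  steps-∷⁻ a (b ∷ l) v = let u , w = Equivalence.to T-∧ v in ℕ.<ᵇ⇒< a q u , w

  steps-∷⁺ : ∀ a l → a < branch l → T (validSteps d l) → T (validSteps d (a ∷ l))
  steps-∷⁺ a [] a< _ = ℕ.<⇒<ᵇ a<
  steps-∷⁺ a (b ∷ l) a< w = Equivalence.from T-∧ (ℕ.<⇒<ᵇ a< , w)

  vertex : ∀ l → length l ≤ h → T (validSteps d l) → Vertex d h
  vertex l len steps = l , Equivalence.from T-∧ (ℕ.≤⇒≤ᵇ len , steps)

  depth≤h : (v : Vertex d h) → length (proj₁ v) ≤ h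
  depth≤h (l , p) = ℕ.≤ᵇ⇒≤ (length l) h (proj₁ (Equivalence.to T-∧ p))

  steps : (v : Vertex d h) → T (validSteps d (proj₁ v))
  steps (l , p) = proj₂ (Equivalence.to (T-∧ {length l ≤ᵇ h}) p)

  vertex-≡ : ∀ {u v : Vertex d h} → proj₁ u ≡ proj₁ v → u ≡ v
  vertex-≡ {l , p} {.l , p′} refl = cong (l ,_) (T-irrelevant p p′)

  _≟ⱽ_ : (u v : Vertex d h) → Dec (u ≡ v)
  u ≟ⱽ v = map′ vertex-≡ (cong proj₁) (≡-dec ℕ._≟_ (proj₁ u) (proj₁ v))

  -- A superset of the paths, with d letters allowed at every step; `collect` then keeps the valid
  -- ones.
  words : ℕ → List (List ℕ)
  words zero = [] ∷ []
  words (suc n) = [] ∷ cartesianProductWith _∷_ (upTo d) (words n)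

  ∈-words : ∀ n l → length l ≤ n → T (validSteps d l) → l ∈ words n
  ∈-words zero [] _ _ = here refl
  ∈-words (suc n) [] _ _ = here refl
  ∈-words (suc n) (a ∷ l) (s≤s len) v with steps-∷⁻ a l v
  ... | a< , w = there (∈-cartesianProductWith⁺ _∷_ (∈-upTo⁺ (ℕ.<-≤-trans a< (branch≤d l))) (∈-words n l len w))
    where
    branch≤d : ∀ l → branch l ≤ d
    branch≤d [] = ℕ.≤-refl
    branch≤d (_ ∷ _) = ℕ.n≤1+n q

  collect : List (List ℕ) → List (Vertex d h)
  collect [] = []
  collect (l ∷ ls) with T? (validVertex d h l)
  ... | yes p = (l , p) ∷ collect ls
  ... | no _ = collect ls

  ∈-collect : ∀ {ls} (v : Vertex d h) → proj₁ v ∈ ls → v ∈ collect ls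
  ∈-collect {l ∷ ls} v (here eq) with T? (validVertex d h l)
  ... | yes p = here (vertex-≡ eq)
  ... | no ¬p = ⊥-elim (¬p (subst (T ∘ validVertex d h) eq (proj₂ v)))
  ∈-collect {l ∷ ls} v (there l∈) with T? (validVertex d h l)
  ... | yes _ = there (∈-collect v l∈)
  ... | no _ = ∈-collect v l∈

  -- Deduplication provides directly the uniqueness that `∑-single` asks for.
  vertices : List (Vertex d h)
  vertices = deduplicate _≟ⱽ_ (collect (words h))

  vertices-unique : Unique vertices
  vertices-unique = deduplicate-! _≟ⱽ_ (collect (words h))

  ∈-vertices : ∀ v → v ∈ vertices
  ∈-vertices v = ∈-deduplicate⁺ _≟ⱽ_ (∈-collect v (∈-words h (proj₁ v) (depth≤h v) (steps v)))

  -- The basis vector at a path, which is zero when the path is not a vertex; for l = proj₁ i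
  -- it is definitionally basis i.
  e : List ℕ → Z
  e l v = ind ⌊ ≡-dec ℕ._≟_ l (proj₁ v) ⌋

  e-≡ : ∀ {l} v → l ≡ proj₁ v → e l v ≡ 1ℤ
  e-≡ {l} v eq with ≡-dec ℕ._≟_ l (proj₁ v)
  ... | yes _ = refl
  ... | no ≢ = ⊥-elim (≢ eq)

  e-≢ : ∀ {l} v → l ≢ proj₁ v → e l v ≡ 0ℤ
  e-≢ {l} v ≢ with ≡-dec ℕ._≟_ l (proj₁ v)
  ... | yes eq = ⊥-elim (≢ eq)
  ... | no _ = refl

  e-deep : ∀ {l} → length l ≡ suc h → ∀ v → e l v ≡ 0ℤ
  e-deep len v = e-≢ v λ { refl → ℕ.<-irrefl refl (subst (_≤ h) len (depth≤h v)) }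

  -- The range of j ignores the depth. At a leaf the formal children have length h + 1, where `e`
  -- vanishes, so leaves need no separate case.
  children : ∀ i v → ind (parentIs v i) ≡ ∑ (upTo (branch (proj₁ i))) (λ j → e (j ∷ proj₁ i) v)
  children (l , _) v@([] , _) = sym (∑-zero (upTo (branch l)) (λ {j} _ → e-≢ {j ∷ l} v λ ()))
  children (l , _) v@(a ∷ l′ , _) with ≡-dec ℕ._≟_ l′ l
  ... | yes refl = sym (trans
    (∑-single (upTo⁺ (branch l)) (∈-upTo⁺ (proj₁ (steps-∷⁻ a l (steps v))))
      (λ j a≢j → e-≢ {j ∷ l} v λ { refl → a≢j refl }))
    (e-≡ {a ∷ l} v refl))
  ... | no l′≢l = sym (∑-zero (upTo (branch l)) (λ {j} _ → e-≢ {j ∷ l} v λ { refl → l′≢l refl }))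

  bases : List Z
  bases = map basis vertices

  -- Expand x in the standard basis. This reduces statements about all of ℤ^V to basis vectors.
  spanning : ∀ {B} → IsLattice B → (∀ {b} → b ∈ bases → B b) → ∀ x → B x
  spanning {B} L in-B x = resp-≗ L (partial vertices (λ i∈ → in-B (∈-map⁺ basis i∈))) expand
    where
    partial : ∀ is → (∀ {i} → i ∈ is → B (basis i)) → B (λ v → ∑ is (λ i → x i *ℤ basis i v))
    partial [] _ = L .zero-in
    partial (i ∷ is) b = plus L (scale L (x i) (b (here refl))) (partial is (b ∘ there)) (λ _ → refl)
    expand : ∀ v → x v ≡ ∑ vertices (λ i → x i *ℤ basis i v)
    expand v = sym (trans
      (∑-single vertices-unique (∈-vertices v)
        (λ i v≢i → trans (cong (x i *ℤ_) (e-≢ {proj₁ i} v (v≢i ∘ sym ∘ vertex-≡))) (ℤ.*-zeroʳ (x i))))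
      (trans (cong (x v *ℤ_) (e-≡ {proj₁ v} v refl)) (ℤ.*-identityʳ (x v))))

  -- The numbers a_n, their recurrence and their coprimality to q.

  a : ℕ → ℕ
  a zero = 0
  a (suc n) = suc (q * a n)

  α : ℕ → ℤ
  α n = + a n

  α-suc : ∀ n → α (suc n) ≡ 1ℤ +ℤ + q *ℤ α n
  α-suc n = cong (1ℤ +ℤ_) (ℤ.pos-* q (a n))

  -- With d = 1 + q, both sides equal (1 + q)(1 + q a_n). The relation drives the elimination and
  -- also makes `weight` harmonic away from the root.
  α-rec : ∀ n → + d *ℤ α (suc n) ≡ α (suc (suc n)) +ℤ + q *ℤ α n
  α-rec n = trans (cong (+ d *ℤ_) (α-suc n)) (trans (id (+ q) (α n)) (cong (_+ℤ + q *ℤ α n)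
    (sym (trans (α-suc (suc n)) (cong (λ x → 1ℤ +ℤ + q *ℤ x) (α-suc n))))))
    where
    id : ∀ Q A → (1ℤ +ℤ Q) *ℤ (1ℤ +ℤ Q *ℤ A) ≡ (1ℤ +ℤ Q *ℤ (1ℤ +ℤ Q *ℤ A)) +ℤ Q *ℤ A
    id = solve-∀

  -- The source of q^h: at the root exactly the difference a_{h+1} - a_h survives.
  α-diff : ∀ n → α (suc n) ≡ α n +ℤ + (q ^ n)
  α-diff zero = trans (α-suc 0) (cong (1ℤ +ℤ_) (ℤ.*-zeroʳ (+ q)))
  α-diff (suc n) = trans (α-suc (suc n)) (trans (cong (λ m → 1ℤ +ℤ + q *ℤ m) (α-diff n))
    (trans (id (+ q) (α n) (+ (q ^ n))) (cong₂ _+ℤ_ (sym (α-suc n)) (sym (ℤ.pos-* q (q ^ n))))))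
    where
    id : ∀ Q A B → 1ℤ +ℤ Q *ℤ (A +ℤ B) ≡ (1ℤ +ℤ Q *ℤ A) +ℤ Q *ℤ B
    id = solve-∀

  coprime-1+ : ∀ {m} → q ∣ m → Coprime (suc m) q
  coprime-1+ {m} q∣m {i} (i∣1+m , i∣q) = ∣1⇒≡1 (∣m+n∣m⇒∣n (subst (i ∣_) (ℕ.+-comm 1 m) i∣1+m) (∣-trans i∣q q∣m))

  coprime-a : ∀ n → Coprime (a (suc n)) q
  coprime-a n = coprime-1+ (m∣m*n (a n))

  coprime-d : Coprime d q
  coprime-d = coprime-1+ ∣-refl

  -- Elimination towards the root and reduction to ⟨g⟩.

  ∑-span : ∀ js m (F : ℕ → Z) (t : Z) → (∀ {j} → j ∈ js → Span (λ v → m *ℤ F j v -ℤ t v)) →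
           Span (λ v → m *ℤ ∑ js (λ j → F j v) -ℤ + length js *ℤ t v)
  ∑-span [] m F t s = resp-≗ span-lattice (span-lattice .zero-in) (λ v → id m (t v))
    where
    id : ∀ m t → m *ℤ 0ℤ -ℤ 0ℤ *ℤ t ≡ 0ℤ
    id = solve-∀
  ∑-span (j ∷ js) m F t s = plus span-lattice (s (here refl)) (∑-span js m F t (s ∘ there))
    (λ v → id m (F j v) (∑ js (λ j → F j v)) (+ length js) (t v))
    where
    id : ∀ m x y n t → m *ℤ (x +ℤ y) -ℤ (1ℤ +ℤ n) *ℤ t ≡ (m *ℤ x -ℤ t) +ℤ (m *ℤ y -ℤ n *ℤ t)
    id = solve-∀

  -- Elimination upwards, starting at n = 0 one level below the leaves, where e (b ∷ l) vanishes.
  climb : ∀ (n b : ℕ) (l : List ℕ) → T (validSteps d (b ∷ l)) → length (b ∷ l) + n ≡ suc h →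
          Span (λ v → α (suc n) *ℤ e (b ∷ l) v -ℤ α n *ℤ e l v)
  climb zero b l w len = resp-≗ span-lattice (span-lattice .zero-in)
    (λ v → trans (cong (λ x → α 1 *ℤ x -ℤ 0ℤ *ℤ e l v) (e-deep {b ∷ l} (trans (sym (ℕ.+-identityʳ _)) len) v))
                 (id (α 1) (e l v)))
    where
    id : ∀ m y → m *ℤ 0ℤ -ℤ 0ℤ *ℤ y ≡ 0ℤ
    id = solve-∀
  -- With c = b ∷ l, inserting the child relations a_{n+1} x_j = a_n x_c into a_{n+1} δ_c gives (d
  -- a_{n+1} - q a_n) x_c = a_{n+1} x_l, and the coefficient on the left is a_{n+2} by `α-rec`.
  climb (suc n) b l w len = plus span-lattice (scale span-lattice (α (suc n)) (span-δ i))
    (subst (λ k → Span (λ v → α (suc n) *ℤ S v -ℤ + k *ℤ (α n *ℤ e c v))) (length-upTo q)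
      (∑-span (upTo q) (α (suc n)) (λ j → e (j ∷ c)) (λ v → α n *ℤ e c v)
        (λ {j} j∈ → climb n j c (steps-∷⁺ j c (∈-upTo⁻ j∈) w) (trans (sym (ℕ.+-suc (suc (length l)) n)) len))))
    (λ v → trans (id₁ (α (suc (suc n))) (+ q *ℤ α n) (e c v) (α (suc n) *ℤ e l v))
      (trans (cong (λ m → (m -ℤ + q *ℤ α n) *ℤ e c v -ℤ α (suc n) *ℤ e l v) (sym (α-rec n)))
      (trans (id₂ (+ d) (α (suc n)) (+ q) (α n) (e c v) (e l v) (S v))
        (cong (λ s → α (suc n) *ℤ ((+ d *ℤ e c v -ℤ e l v) -ℤ s) +ℤ (α (suc n) *ℤ S v -ℤ + q *ℤ (α n *ℤ e c v)))
          (sym (children i v))))))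
    where
    c = b ∷ l
    i : Vertex d h
    i = vertex c (s≤s⁻¹ (subst (suc (length c) ≤_) (trans (sym (ℕ.+-suc (length c) n)) len) (ℕ.m≤m+n _ n))) w
    S : Z
    S v = ∑ (upTo q) (λ j → e (j ∷ c) v)
    id₁ : ∀ A B x Y → A *ℤ x -ℤ Y ≡ ((A +ℤ B) -ℤ B) *ℤ x -ℤ Y
    id₁ = solve-∀
    id₂ : ∀ D A Q B x y s → (D *ℤ A -ℤ Q *ℤ B) *ℤ x -ℤ A *ℤ y
          ≡ A *ℤ ((D *ℤ x -ℤ y) -ℤ s) +ℤ (A *ℤ s -ℤ Q *ℤ (B *ℤ x))
    id₂ = solve-∀

  -- The factor d reflects the d children of the root: elimination ends in a relation on x_0 whose
  -- coefficient is d q^h.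
  g : Z
  g = scaleV (+ d) (e [])

  root : Vertex d h
  root = vertex [] z≤n tt

  -- Inserting a_{h+1} x_j = a_h x_0 for the d children into a_{h+1} δ_0 leaves d (a_{h+1} - a_h)
  -- x_0, which is q^h g.
  killed : Span (scaleV (+ (q ^ h)) g)
  killed = plus span-lattice (scale span-lattice (α (suc h)) (span-δ root))
    (subst (λ k → Span (λ v → α (suc h) *ℤ S v -ℤ + k *ℤ (α h *ℤ e [] v))) (length-upTo d)
      (∑-span (upTo d) (α (suc h)) (λ j → e (j ∷ [])) (λ v → α h *ℤ e [] v)
        (λ {j} j∈ → climb h j [] (steps-∷⁺ j [] (∈-upTo⁻ j∈) tt) refl)))
    (λ v → trans (id (+ (q ^ h)) (+ d) (α h) (e [] v) (S v))
      (cong₂ (λ A s → A *ℤ ((+ d *ℤ e [] v -ℤ 0ℤ) -ℤ s) +ℤ (A *ℤ S v -ℤ + d *ℤ (α h *ℤ e [] v)))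
        (sym (α-diff h)) (sym (children root v))))
    where
    S : Z
    S v = ∑ (upTo d) (λ j → e (j ∷ []) v)
    id : ∀ T D A x s → T *ℤ (D *ℤ x)
         ≡ (A +ℤ T) *ℤ ((D *ℤ x -ℤ 0ℤ) -ℤ s) +ℤ ((A +ℤ T) *ℤ s -ℤ D *ℤ (A *ℤ x))
    id = solve-∀

  -- Clears the coefficients met between depth k and the root: the edge into depth k + 1 costs
  -- a_{h+1-k}, and the initial d turns x_0 into g.
  multiplier : ℕ → ℕ
  multiplier zero = d
  multiplier (suc k) = multiplier k * a (suc (h ∸ k))

  coprime-multiplier : ∀ k → Coprime (multiplier k) q
  coprime-multiplier zero = coprime-d
  coprime-multiplier (suc k) = coprime-* {multiplier k} (coprime-multiplier k) (coprime-a (h ∸ k))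

  path-reduce : ∀ k c → T (validSteps d c) → length c ≤ k → k ≤ h → Ext Span g (scaleV (+ multiplier k) (e c))
  path-reduce zero [] _ _ _ = ext-∋ span-lattice g
  path-reduce (suc k) c w len k<h with ℕ.m≤n⇒m<n∨m≡n len
  ... | inj₁ (s≤s len′) = resp-≗ P (scale P (α (suc (h ∸ k))) (path-reduce k c w len′ (ℕ.<⇒≤ k<h)))
    (λ v → trans (cong (_*ℤ e c v) (ℤ.pos-* (multiplier k) (a (suc (h ∸ k)))))
                 (id (+ multiplier k) (α (suc (h ∸ k))) (e c v)))
    where
    P = ext-lattice span-lattice g
    id : ∀ m A x → m *ℤ A *ℤ x ≡ A *ℤ (m *ℤ x)
    id = solve-∀
  path-reduce (suc k) (b ∷ l) w len k<h | inj₂ refl =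
    plus P (scale P (+ multiplier k) (ext-⊇ span-lattice g (climb (h ∸ k) b l w (cong suc (ℕ.m+[n∸m]≡n (ℕ.<⇒≤ k<h))))))
           (scale P (α (h ∸ k)) (path-reduce k l (proj₂ (steps-∷⁻ b l w)) ℕ.≤-refl (ℕ.<⇒≤ k<h)))
    (λ v → trans (cong (_*ℤ e (b ∷ l) v) (ℤ.pos-* (multiplier k) (a (suc (h ∸ k)))))
                 (id (+ multiplier k) (α (suc (h ∸ k))) (α (h ∸ k)) (e (b ∷ l) v) (e l v)))
    where
    P = ext-lattice span-lattice g
    id : ∀ m A B x y → m *ℤ A *ℤ x ≡ m *ℤ (A *ℤ x -ℤ B *ℤ y) +ℤ B *ℤ (m *ℤ y)
    id = solve-∀

  -- Having its k-fold multiple in A is again a lattice condition, so `reduce` may be checked on the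
  -- basis.
  scaled-lattice : ∀ {A} → IsLattice A → ∀ k → IsLattice (λ x → A (scaleV k x))
  scaled-lattice L k .IsLattice.zero-in = resp-≗ L (L .zero-in) (λ _ → ℤ.*-zeroʳ k)
  scaled-lattice L k .comb m n {s} {t} x y eq =
    L .comb m n x y (λ v → trans (cong (k *ℤ_) (eq v)) (id k m n (s v) (t v)))
    where
    id : ∀ k m n s t → k *ℤ (m *ℤ s +ℤ n *ℤ t) ≡ m *ℤ (k *ℤ s) +ℤ n *ℤ (k *ℤ t)
    id = solve-∀

  K : ℕ
  K = multiplier h

  reduce : ∀ x → Ext Span g (scaleV (+ K) x)
  reduce = spanning (scaled-lattice (ext-lattice span-lattice g) (+ K)) λ b∈ → on-basis (∈-map⁻ basis b∈)
    where
    on-basis : ∀ {b} → ∃[ i ] i ∈ vertices × b ≡ basis i → Ext Span g (scaleV (+ K) b)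
    on-basis (i , _ , refl) = path-reduce h (proj₁ i) (steps i) (depth≤h i) ℕ.≤-refl

  -- A multiple of every vector lies in Span, so Span is the sum of the δ's and a sublattice
  -- m ℤ^V, whose membership is a finite check.
  module _ {m : ℕ} (m≢0 : NonZero m) (kills : ∀ x → Span (scaleV (+ m) x)) where

    Divisible : Z → Set
    Divisible x = ∀ v → + m ∣ℤ x v

    divisible-lattice : IsLattice Divisible
    divisible-lattice .IsLattice.zero-in _ = divides 0ℤ refl
    divisible-lattice .comb k l s t eq v =
      subst (+ m ∣ℤ_) (sym (eq v)) (∣m∣n⇒∣m+n (∣n⇒∣m*n k (s v)) (∣n⇒∣m*n l (t v)))

    divisible? : ∀ x → Dec (Divisible x)
    divisible? x = map′ (λ all v → All.lookup all (∈-vertices v)) (λ div → All.tabulate (λ {v} _ → div v))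
      (All.all? (λ v → + m ∣ℤ? x v) vertices)

    span?  : ∀ x → Dec (Span x)
    span? x = map′
      (gen-⊆ span-lattice divisible⊆span δs (λ b∈ → δ-in (∈-map⁻ (δ d) b∈)))
      (span⊆ (gen-lattice divisible-lattice δs) (λ i → gen-∋ divisible-lattice (∈-map⁺ (δ d) (∈-vertices i))))
      (gen? {m} {{m≢0}} divisible-lattice divisible? δs (λ {x} _ v → ∣m⇒∣m*n (x v) ∣-reflℤ) x)
      where
      δs = map (δ d) vertices
      ∣-reflℤ : + m ∣ℤ + m
      ∣-reflℤ = divides 1ℤ (sym (ℤ.*-identityˡ (+ m)))
      δ-in : ∀ {b} → ∃[ i ] i ∈ vertices × b ≡ δ d i → Span b
      δ-in (i , _ , refl) = span-δ i
      divisible⊆span : ∀ {x} → Divisible x → Span x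
      divisible⊆span div = resp-≗ span-lattice (kills (λ v → quotient (div v)))
        (λ v → trans (_∣ℤ_.equality (div v)) (ℤ.*-comm (quotient (div v)) (+ m)))

  -- The radial pairing and the exact order of g.

  weight : Vertex d h → ℤ
  weight v = α (suc h ∸ length (proj₁ v))

  -- The radial function weight is harmonic modulo q^h, so φ descends to a map G(d,h) → ℤ/q^h.
  φ : Z → ℤ
  φ x = ∑ vertices (λ v → x v *ℤ weight v)

  φ-comb : ∀ m n (s t : Z) {z : Z} → (∀ v → z v ≡ m *ℤ s v +ℤ n *ℤ t v) → φ z ≡ m *ℤ φ s +ℤ n *ℤ φ t
  φ-comb m n s t eq = ∑-comb vertices m n
    (λ v → trans (cong (_*ℤ weight v) (eq v)) (id m n (s v) (t v) (weight v)))
    where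
    id : ∀ m n s t w → (m *ℤ s +ℤ n *ℤ t) *ℤ w ≡ m *ℤ (s *ℤ w) +ℤ n *ℤ (t *ℤ w)
    id = solve-∀

  φ-e : ∀ l → T (validSteps d l) → length l ≤ suc h → φ (e l) ≡ α (suc h ∸ length l)
  φ-e l w len with ℕ.m≤n⇒m<n∨m≡n len
  ... | inj₁ (s≤s len′) = trans
    (∑-single {i = i} vertices-unique (∈-vertices i)
      (λ v i≢v → trans (cong (_*ℤ weight v) (e-≢ {l} v (i≢v ∘ vertex-≡))) (ℤ.*-zeroˡ (weight v))))
    (trans (cong (_*ℤ weight i) (e-≡ {l} i refl)) (ℤ.*-identityˡ (weight i)))
    where
    i = vertex l len′ w
  ... | inj₂ len≡ = trans
    (∑-zero vertices (λ {v} _ → trans (cong (_*ℤ weight v) (e-deep {l} len≡ v)) (ℤ.*-zeroˡ (weight v))))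
    (cong α (sym (trans (cong (suc h ∸_) len≡) (ℕ.n∸n≡0 (suc h)))))

  φ-∑ : ∀ js (F : ℕ → Z) c → (∀ {j} → j ∈ js → φ (F j) ≡ c) → φ (λ v → ∑ js (λ j → F j v)) ≡ + length js *ℤ c
  φ-∑ [] F c eq = trans (∑-zero vertices (λ {v} _ → ℤ.*-zeroˡ (weight v))) (sym (ℤ.*-zeroˡ c))
  φ-∑ (j ∷ js) F c eq = trans (φ-comb 1ℤ 1ℤ (F j) (λ v → ∑ js (λ j → F j v)) (λ v → id₁ (F j v) (∑ js (λ j → F j v))))
    (trans (cong₂ (λ x y → 1ℤ *ℤ x +ℤ 1ℤ *ℤ y) (eq (here refl)) (φ-∑ js F c (eq ∘ there))) (id₂ (+ length js) c))
    where
    id₁ : ∀ x y → x +ℤ y ≡ 1ℤ *ℤ x +ℤ 1ℤ *ℤ y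
    id₁ = solve-∀
    id₂ : ∀ n c → 1ℤ *ℤ c +ℤ 1ℤ *ℤ (n *ℤ c) ≡ (1ℤ +ℤ n) *ℤ c
    id₂ = solve-∀

  φ-children : ∀ i → let l = proj₁ i in
    φ (λ v → ∑ (upTo (branch l)) (λ j → e (j ∷ l) v)) ≡ + branch l *ℤ α (h ∸ length l)
  φ-children i@(l , _) = trans
    (φ-∑ (upTo (branch l)) (λ j → e (j ∷ l)) (α (h ∸ length l))
      (λ {j} j∈ → φ-e (j ∷ l) (steps-∷⁺ j l (∈-upTo⁻ j∈) (steps i)) (s≤s (depth≤h i))))
    (cong (λ n → + n *ℤ α (h ∸ length l)) (length-upTo (branch l)))

  φ-δ : ∀ i → + (q ^ h) ∣ℤ φ (δ d i)
  -- At the root the value is d a_{h+1} - d a_h = d q^h.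
  φ-δ i@([] , _) = divides (+ d) (trans (φ-comb (+ d) -1ℤ (e []) S
      (λ v → trans (cong (λ s → (+ d *ℤ e [] v -ℤ 0ℤ) -ℤ s) (children i v)) (id₁ (+ d) (e [] v) (S v))))
    (trans (cong₂ (λ x y → + d *ℤ x +ℤ -1ℤ *ℤ y) (trans (φ-e [] tt z≤n) (α-diff h)) (φ-children i))
      (id₂ (+ d) (α h) (+ (q ^ h)))))
    where
    S : Z
    S v = ∑ (upTo d) (λ j → e (j ∷ []) v)
    id₁ : ∀ D x s → (D *ℤ x -ℤ 0ℤ) -ℤ s ≡ D *ℤ x +ℤ -1ℤ *ℤ s
    id₁ = solve-∀
    id₂ : ∀ D A T → D *ℤ (A +ℤ T) +ℤ -1ℤ *ℤ (D *ℤ A) ≡ D *ℤ T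
    id₂ = solve-∀
  -- Parent, vertex and children have weights a_{n+2}, a_{n+1} and a_n, where n is h minus the depth
  -- of i, so `α-rec` makes the value 0.
  φ-δ i@(b ∷ l , _) = divides 0ℤ (trans (φ-comb 1ℤ -1ℤ (λ v → + d *ℤ e (b ∷ l) v -ℤ e l v) S
      (λ v → trans (cong (λ s → (+ d *ℤ e (b ∷ l) v -ℤ e l v) -ℤ s) (children i v))
                   (id₁ (+ d *ℤ e (b ∷ l) v -ℤ e l v) (S v))))
    (trans (cong₂ (λ x y → 1ℤ *ℤ x +ℤ -1ℤ *ℤ y)
      (trans (φ-comb (+ d) -1ℤ (e (b ∷ l)) (e l) (λ v → id₂ (+ d) (e (b ∷ l) v) (e l v)))
        (cong₂ (λ x y → + d *ℤ x +ℤ -1ℤ *ℤ y)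
          (trans (φ-e (b ∷ l) (steps i) (ℕ.m≤n⇒m≤1+n l<h)) (cong α h∸l))
          (trans (φ-e l (proj₂ (steps-∷⁻ b l (steps i))) (ℕ.m≤n⇒m≤1+n (ℕ.<⇒≤ l<h)))
            (cong α (trans (ℕ.+-∸-assoc 1 (ℕ.<⇒≤ l<h)) (cong suc h∸l))))))
      (φ-children i))
      (trans (cong (λ x → 1ℤ *ℤ (x +ℤ -1ℤ *ℤ α (suc (suc n))) +ℤ -1ℤ *ℤ (+ q *ℤ α n)) (α-rec n))
        (id₃ (α (suc (suc n))) (+ q *ℤ α n) (+ (q ^ h))))))
    where
    l<h : length l < h
    l<h = depth≤h i
    n = h ∸ suc (length l)
    h∸l : h ∸ length l ≡ suc n
    h∸l = ℕ.+-∸-assoc 1 l<h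
    S : Z
    S v = ∑ (upTo q) (λ j → e (j ∷ b ∷ l) v)
    id₁ : ∀ x s → x -ℤ s ≡ 1ℤ *ℤ x +ℤ -1ℤ *ℤ s
    id₁ = solve-∀
    id₂ : ∀ D x y → D *ℤ x -ℤ y ≡ D *ℤ x +ℤ -1ℤ *ℤ y
    id₂ = solve-∀
    id₃ : ∀ A B T → 1ℤ *ℤ ((A +ℤ B) +ℤ -1ℤ *ℤ A) +ℤ -1ℤ *ℤ B ≡ 0ℤ *ℤ T
    id₃ = solve-∀

  φ-span : ∀ {x} → Span x → + (q ^ h) ∣ℤ φ x
  φ-span = span⊆ φ-lattice φ-δ
    where
    φ-lattice : IsLattice (λ x → + (q ^ h) ∣ℤ φ x)
    φ-lattice .IsLattice.zero-in = divides 0ℤ (∑-zero vertices (λ {v} _ → ℤ.*-zeroˡ (weight v)))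
    φ-lattice .comb m n {s} {t} s-in t-in eq =
      subst (+ (q ^ h) ∣ℤ_) (sym (φ-comb m n s t eq)) (∣m∣n⇒∣m+n (∣n⇒∣m*n m s-in) (∣n⇒∣m*n n t-in))

  -- The pairing sends r g to r d a_{h+1}, which q^h must divide; d and a_{h+1} are prime to q and
  -- can be cancelled.
  faithful : ∀ r → Span (scaleV (+ r) g) → q ^ h ∣ r
  faithful r s = coprime-divisor
    (coprime-by-primes (λ p → prime∣^ q h) (coprime-sym (coprime-* coprime-d (coprime-a h))))
    (subst (q ^ h ∣_) (ℕ.*-comm r (d * a (suc h)))
      (∣⇒∣ᵤ (subst (+ (q ^ h) ∣ℤ_) φ-rg (φ-span s))))
    where
    id : ∀ r D x → r *ℤ (D *ℤ x) ≡ r *ℤ D *ℤ x +ℤ 0ℤ *ℤ x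
    id = solve-∀
    id′ : ∀ r D A → r *ℤ D *ℤ A +ℤ 0ℤ *ℤ A ≡ r *ℤ (D *ℤ A)
    id′ = solve-∀
    φ-rg : φ (scaleV (+ r) g) ≡ + (r * (d * a (suc h)))
    φ-rg = trans (φ-comb (+ r *ℤ + d) 0ℤ (e []) (e []) (λ v → id (+ r) (+ d) (e [] v)))
      (trans (cong (λ x → + r *ℤ + d *ℤ x +ℤ 0ℤ *ℤ x) (φ-e [] tt z≤n))
      (trans (id′ (+ r) (+ d) (α (suc h)))
      (trans (cong (+ r *ℤ_) (sym (ℤ.pos-* d (a (suc h))))) (sym (ℤ.pos-* r (d * a (suc h)))))))

theorem2p8 : (d h : ℕ) → 3 ≤ d → 1 ≤ h →
    Σ (ZV d h → Set) (IsHall d h (d ∸ 1)) ×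
    ((P : ZV d h → Set) → IsHall d h (d ∸ 1) P →
    IsCyclic d h P × HasSize d h P ((d ∸ 1) ^ h))
theorem2p8 (suc q) h (s≤s 2≤q) 1≤h =
  (_ , hall decide bases spanning q≢0 h≢0 g killed faithful K≢0 (coprime-multiplier h) reduce) ,
  hall-unique decide bases spanning q≢0 h≢0 g killed faithful K≢0 (coprime-multiplier h) reduce
  where
  open Tree q h
  open Hall d h
  q≢0 : NonZero q
  q≢0 = >-nonZero (ℕ.<⇒≤ 2≤q)
  h≢0 : NonZero h
  h≢0 = >-nonZero 1≤h
  K≢0 : NonZero K
  -- Zero is coprime to q only if q = 1, which d ≥ 3 excludes.
  K≢0 = ≢-nonZero λ K≡0 → ℕ.<⇒≢ 2≤q
    (sym (0-coprimeTo-m⇒m≡1 (subst (λ n → Coprime n q) K≡0 (coprime-multiplier h))))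
  -- The modulus is q^h K: multiplication by K lands in ⟨g⟩, and q^h kills the result.
  decide = span? (ℕ.m*n≢0 (q ^ h) K {{ℕ.m^n≢0 q h {{q≢0}}}} {{K≢0}}) (kill-all {g} {q ^ h} killed {K} reduce)
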